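{- The cubic hypersurface in $\mathbb{P}^4_{\mathbb{C}}$, with homogeneous coordinates $f_1,\dots,f_5$, defined by $$5\sigma_1^3-18\sigma_1\sigma_2+27\sigma_3=0,$$ where $\sigma_i=\sigma_i(f_1,\dots,f_5)$ is the degree $i$ elementary symmetric polynomial, is (up to a linear change of coordinates) the Segre cubic.
   Context: The Segre cubic is the cubic threefold $$\{[y_1:\cdots:y_6]\in\mathbb{P}^5_{\mathbb{C}}: y_1+\cdots+y_6=0,\ y_1^3+\cdots+y_6^3=0\},$$ regarded as a cubic hypersurface in the hyperplane $\{y_1+\cdots+y_6=0\}\cong\mathbb{P}^4_{\mathbb{C}}$. -}

module Defs where

open import Algebra.Bundles using (CommutativeRing; Semiring)
open import Algebra.Definitions using (Invertible)
open import Algebra.Module.Bundles using (Module)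
open import Algebra.Module.Structures.Biased using (module IsModuleFromLeft)
open import Algebra.Module.Morphism.Structures using (module ModuleMorphisms)
import Data.Fin.Base as Fin
open import Data.List.Base as List using (List; []; _∷_; _++_)
open import Data.Nat.Base as ℕ using (ℕ; zero; suc)
import Data.Nat.Properties as ℕ
open import Data.Product.Base using (Σ; Σ-syntax; ∃; _×_; _,_; proj₁; proj₂)
open import Data.Rational.Base as ℚ using (ℚ; 0ℚ; 1ℚ; ½)
import Data.Rational.Properties as ℚ
open import Data.Vec.Functional as Vector using (Vector)
open import Function.Base using (_∘_)
open import Function.Bundles using (_⇔_)
open import Level using (Level; 0ℓ; _⊔_)
open import Relation.Binary.Bundles using (Setoid)
open import Relation.Binary.PropositionalEquality as ≡ using (_≡_)
open import Relation.Unary using (Pred; _∈_)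
open import Relation.Nullary.Negation using (¬_)
import Algebra.Definitions.RawSemiring as RawSemiringDefs
import Algebra.Properties.CommutativeMonoid.Sum as SumProperties
import Algebra.Properties.CommutativeSemigroup as CommutativeSemigroupProperties
import Algebra.Properties.Ring as RingProperties
import Algebra.Properties.Semiring.Sum as SemiringSumProperties
import Relation.Binary.Reasoning.Setoid as SetoidReasoning

------------------------------------------------------------------------
-- Rational-valued families u : A → ℚ tending to 0, where late N a says
-- that the index a is beyond stage N.

module Limit {A : Set} (late : ℕ → A → Set)
             (earlier : ∀ {M N a} → M ℕ.≤ N → late N a → late M a) where

  Vanishes : (A → ℚ) → Set
  Vanishes u = ∀ ε → 0ℚ ℚ.< ε → ∃ λ N → ∀ a → late N a → ℚ.∣ u a ∣ ℚ.< ε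

  EventuallyBounded : (A → ℚ) → Set
  EventuallyBounded b =
    Σ[ B ∈ ℚ ] 0ℚ ℚ.< B × ∃ λ N → ∀ a → late N a → ℚ.∣ b a ∣ ℚ.≤ B

  vanishes-resp : ∀ {u v} → (∀ a → u a ≡ v a) → Vanishes u → Vanishes v
  vanishes-resp u≡v uz ε ε>0 with uz ε ε>0
  ... | N , h = N , λ a l → ≡.subst (λ q → ℚ.∣ q ∣ ℚ.< ε) (u≡v a) (h a l)

  vanishes-0 : Vanishes (λ _ → 0ℚ)
  vanishes-0 ε ε>0 = 0 , λ _ _ → ε>0

  vanishes-neg : ∀ {u} → Vanishes u → Vanishes (λ a → ℚ.- u a)
  vanishes-neg {u} uz ε ε>0 with uz ε ε>0
  ... | N , h =
    N , λ a l → ≡.subst (ℚ._< ε) (≡.sym (ℚ.∣-p∣≡∣p∣ (u a))) (h a l)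

  vanishes-+ : ∀ {u v} → Vanishes u → Vanishes v →
               Vanishes (λ a → u a ℚ.+ v a)
  vanishes-+ {u} {v} uz vz ε ε>0
    with uz (ε ℚ.* ½) (ℚ.*-monoˡ-<-pos ½ ε>0)
       | vz (ε ℚ.* ½) (ℚ.*-monoˡ-<-pos ½ ε>0)
  ... | M , h | N , k = M ℕ.⊔ N , λ a l → begin-strict
      ℚ.∣ u a ℚ.+ v a ∣          ≤⟨ ℚ.∣p+q∣≤∣p∣+∣q∣ (u a) (v a) ⟩
      ℚ.∣ u a ∣ ℚ.+ ℚ.∣ v a ∣    <⟨ ℚ.+-mono-<
                                      (h a (earlier (ℕ.m≤m⊔n M N) l))
                                      (k a (earlier (ℕ.m≤n⊔m M N) l)) ⟩
      ε ℚ.* ½ ℚ.+ ε ℚ.* ½        ≡⟨ ℚ.*-distribˡ-+ ε ½ ½ ⟨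
      ε ℚ.* 1ℚ                   ≡⟨ ℚ.*-identityʳ ε ⟩
      ε                          ∎
    where open ℚ.≤-Reasoning

  vanishes-* : ∀ {b u} → EventuallyBounded b → Vanishes u →
               Vanishes (λ a → b a ℚ.* u a)
  vanishes-* {b} {u} (B , B>0 , M , h) uz ε ε>0
    with uz (B⁻¹ ℚ.* ε) δ>0
    where
    instance
      B-pos : ℚ.Positive B
      B-pos = ℚ.positive B>0
      B-nz : ℚ.NonZero B
      B-nz = ℚ.pos⇒nonZero B
    B⁻¹ : ℚ
    B⁻¹ = ℚ.1/ B
    δ>0 : 0ℚ ℚ.< B⁻¹ ℚ.* ε
    δ>0 = ≡.subst (ℚ._< B⁻¹ ℚ.* ε) (ℚ.*-zeroʳ B⁻¹)
            (ℚ.*-monoʳ-<-pos B⁻¹ {{ℚ.1/pos⇒pos B}} ε>0)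
  ... | N , k = M ℕ.⊔ N , λ a l → begin-strict
      ℚ.∣ b a ℚ.* u a ∣          ≡⟨ ℚ.∣p*q∣≡∣p∣*∣q∣ (b a) (u a) ⟩
      ℚ.∣ b a ∣ ℚ.* ℚ.∣ u a ∣    ≤⟨ ℚ.*-monoʳ-≤-nonNeg ℚ.∣ u a ∣
                                      {{ℚ.nonNegative (ℚ.0≤∣p∣ (u a))}}
                                      (h a (earlier (ℕ.m≤m⊔n M N) l)) ⟩
      B ℚ.* ℚ.∣ u a ∣            <⟨ ℚ.*-monoʳ-<-pos B
                                      (k a (earlier (ℕ.m≤n⊔m M N) l)) ⟩
      B ℚ.* (ℚ.1/ B ℚ.* ε)       ≡⟨ ℚ.*-assoc B (ℚ.1/ B) ε ⟨
      B ℚ.* ℚ.1/ B ℚ.* ε         ≡⟨ ≡.cong (ℚ._* ε) (ℚ.*-inverseʳ B) ⟩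
      1ℚ ℚ.* ε                   ≡⟨ ℚ.*-identityˡ ε ⟩
      ε                          ∎
    where
    open ℚ.≤-Reasoning
    instance
      B-pos : ℚ.Positive B
      B-pos = ℚ.positive B>0
      B-nz : ℚ.NonZero B
      B-nz = ℚ.pos⇒nonZero B

module Lim₁ = Limit {ℕ} ℕ._≤_ ℕ.≤-trans
private
  both-late : ℕ → ℕ × ℕ → Set
  both-late N (m , n) = N ℕ.≤ m × N ℕ.≤ n

  both-earlier : ∀ {M N a} → M ℕ.≤ N → both-late N a → both-late M a
  both-earlier M≤N (p , q) = ℕ.≤-trans M≤N p , ℕ.≤-trans M≤N q

module Lim₂ = Limit both-late (λ {M} {N} {a} → both-earlier {M} {N} {a})

private
  module DifferenceIdentities {c ℓ} (R : CommutativeRing c ℓ) where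
    open CommutativeRing R
    open RingProperties ring
    open CommutativeSemigroupProperties +-commutativeSemigroup
      using (interchange)
    open SetoidReasoning setoid

    add-diff : ∀ a b → a + (b - a) ≈ b
    add-diff a b = trans (sym (+-assoc a b (- a)))
      (trans (+-congʳ (+-comm a b)) (trans (+-assoc b a (- a))
        (trans (+-congˡ (-‿inverseʳ a)) (+-identityʳ b))))

    sum-diff : ∀ a b c d → (a - c) + (b - d) ≈ (a + b) - (c + d)
    sum-diff a b c d =
      trans (interchange a (- c) b (- d)) (+-congˡ (-‿+-comm c d))

    neg-diff : ∀ a b → - (a - b) ≈ (- a) - (- b)
    neg-diff a b = sym (-‿+-comm a (- b))

    flip-diff : ∀ a b → - (a - b) ≈ b - a
    flip-diff a b =
      trans (neg-diff a b) (trans (+-comm _ _) (+-congʳ (-‿involutive b)))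

    chain-diff : ∀ a b c → (a - b) + (b - c) ≈ a - c
    chain-diff a b c = begin
      a - b + (b - c)      ≈⟨ +-assoc a (- b) (b - c) ⟩
      a + (- b + (b - c))  ≈⟨ +-congˡ (+-assoc (- b) b (- c)) ⟨
      a + (- b + b - c)    ≈⟨ +-congˡ (+-congʳ (-‿inverseˡ b)) ⟩
      a + (0# - c)         ≈⟨ +-congˡ (+-identityˡ (- c)) ⟩
      a - c                ∎

    prod-diff : ∀ a b c d → a * (b - d) + d * (a - c) ≈ a * b - c * d
    prod-diff a b c d = begin
      a * (b - d) + d * (a - c)          ≈⟨ +-cong (x[y-z]≈xy-xz a b d)
                                                   (x[y-z]≈xy-xz d a c) ⟩
      (a * b - a * d) + (d * a - d * c)  ≈⟨ +-congˡ (+-cong (*-comm d a)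
                                              (-‿cong (*-comm d c))) ⟩
      (a * b - a * d) + (a * d - c * d)  ≈⟨ chain-diff (a * b) (a * d) (c * d) ⟩
      a * b - c * d                      ∎

------------------------------------------------------------------------
-- The real numbers: Cauchy sequences of rationals modulo null sequences.

Cauchy : (ℕ → ℚ) → Set
Cauchy x = Lim₂.Vanishes (λ { (m , n) → x m ℚ.- x n })

record ℝ : Set where
  constructor real
  field
    seq    : ℕ → ℚ
    cauchy : Cauchy seq
open ℝ public

infix 4 _≈ᴿ_
record _≈ᴿ_ (x y : ℝ) : Set where
  constructor null
  field
    difference-null : Lim₁.Vanishes (λ n → seq x n ℚ.- seq y n)
open _≈ᴿ_ public

private
  open DifferenceIdentities ℚ.+-*-commutativeRing

  bounded : (x : ℝ) → Lim₁.EventuallyBounded (seq x)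
  bounded x with cauchy x 1ℚ (ℚ.positive⁻¹ 1ℚ)
  ... | N , h =
      B , B>0 , N , λ n N≤n → begin
        ℚ.∣ x′ n ∣
          ≡⟨ ≡.cong ℚ.∣_∣
               (≡.sym (add-diff (x′ N) (x′ n))) ⟩
        ℚ.∣ x′ N ℚ.+ (x′ n ℚ.- x′ N) ∣
          ≤⟨ ℚ.∣p+q∣≤∣p∣+∣q∣ (x′ N) (x′ n ℚ.- x′ N) ⟩
        ℚ.∣ x′ N ∣ ℚ.+ ℚ.∣ x′ n ℚ.- x′ N ∣
          ≤⟨ ℚ.+-monoʳ-≤ ℚ.∣ x′ N ∣
               (ℚ.<⇒≤ (h (n , N) (N≤n , ℕ.≤-refl))) ⟩
        B ∎
    where
    open ℚ.≤-Reasoning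
    x′ : ℕ → ℚ
    x′ = seq x
    B : ℚ
    B = ℚ.∣ x′ N ∣ ℚ.+ 1ℚ
    B>0 : 0ℚ ℚ.< B
    B>0 = ℚ.+-mono-≤-< (ℚ.0≤∣p∣ (x′ N)) (ℚ.positive⁻¹ 1ℚ)

  bounded-along : (x : ℝ) (f : ℕ × ℕ → ℕ) →
    (∀ N p → both-late N p → N ℕ.≤ f p) → Lim₂.EventuallyBounded (seq x ∘ f)
  bounded-along x f late =
    let (B , B>0 , N , h) = bounded x
    in B , B>0 , N , λ p l → h (f p) (late N p l)

fromℚ : ℚ → ℝ
fromℚ q = real (λ _ → q)
  (Lim₂.vanishes-resp (λ _ → ≡.sym (ℚ.+-inverseʳ q)) Lim₂.vanishes-0)

infixl 6 _+ᴿ_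
infixl 7 _*ᴿ_
infix  8 -ᴿ_

_+ᴿ_ : ℝ → ℝ → ℝ
x +ᴿ y = real (λ n → seq x n ℚ.+ seq y n)
  (Lim₂.vanishes-resp
    (λ { (m , n) → sum-diff (seq x m) (seq y m) (seq x n) (seq y n) })
    (Lim₂.vanishes-+ (cauchy x) (cauchy y)))

-ᴿ_ : ℝ → ℝ
-ᴿ x = real (λ n → ℚ.- seq x n)
  (Lim₂.vanishes-resp (λ { (m , n) → neg-diff (seq x m) (seq x n) })
    (Lim₂.vanishes-neg (cauchy x)))

_*ᴿ_ : ℝ → ℝ → ℝ
x *ᴿ y = real (λ n → seq x n ℚ.* seq y n)
  (Lim₂.vanishes-resp
    (λ { (m , n) → prod-diff (seq x m) (seq y m) (seq x n) (seq y n) })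
    (Lim₂.vanishes-+
      (Lim₂.vanishes-* (bounded-along x proj₁ λ _ _ → proj₁) (cauchy y))
      (Lim₂.vanishes-* (bounded-along y proj₂ λ _ _ → proj₂) (cauchy x))))

private
  pointwise : ∀ {x y} → (∀ n → seq x n ≡ seq y n) → x ≈ᴿ y
  pointwise {x} {y} x≡y = null (Lim₁.vanishes-resp
    (λ n → ≡.sym (≡.trans (≡.cong (ℚ._- seq y n) (x≡y n))
                          (ℚ.+-inverseʳ (seq y n))))
    Lim₁.vanishes-0)

ℝ-commutativeRing : CommutativeRing 0ℓ 0ℓ
ℝ-commutativeRing = record
  { Carrier = ℝ
  ; _≈_ = _≈ᴿ_
  ; _+_ = _+ᴿ_
  ; _*_ = _*ᴿ_
  ; -_  = -ᴿ_
  ; 0#  = fromℚ 0ℚ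
  ; 1#  = fromℚ 1ℚ
  ; isCommutativeRing = record
    { isRing = record
      { +-isAbelianGroup = record
        { isGroup = record
          { isMonoid = record
            { isSemigroup = record
              { isMagma = record
                { isEquivalence = record
                  { refl  = pointwise λ _ → ≡.refl
                  ; sym   = λ {x} {y} x≈y → null (Lim₁.vanishes-resp
                      (λ n → flip-diff (seq x n) (seq y n))
                      (Lim₁.vanishes-neg (difference-null x≈y)))
                  ; trans = λ {x} {y} {z} x≈y y≈z → null (Lim₁.vanishes-resp
                      (λ n → chain-diff (seq x n) (seq y n) (seq z n))
                      (Lim₁.vanishes-+ (difference-null x≈y)
                                       (difference-null y≈z)))
                  }
                ; ∙-cong = λ {x} {y} {u} {v} x≈y u≈v →
                    null (Lim₁.vanishes-resp
                      (λ n → sum-diff (seq x n) (seq u n) (seq y n) (seq v n))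
                      (Lim₁.vanishes-+ (difference-null x≈y)
                                       (difference-null u≈v)))
                }
              ; assoc = λ x y z → pointwise λ n →
                  ℚ.+-assoc (seq x n) (seq y n) (seq z n)
              }
            ; identity = (λ x → pointwise λ n → ℚ.+-identityˡ (seq x n))
                       , (λ x → pointwise λ n → ℚ.+-identityʳ (seq x n))
            }
          ; inverse = (λ x → pointwise λ n → ℚ.+-inverseˡ (seq x n))
                    , (λ x → pointwise λ n → ℚ.+-inverseʳ (seq x n))
          ; ⁻¹-cong = λ {x} {y} x≈y → null (Lim₁.vanishes-resp
              (λ n → neg-diff (seq x n) (seq y n))
              (Lim₁.vanishes-neg (difference-null x≈y)))
          }
        ; comm = λ x y → pointwise λ n → ℚ.+-comm (seq x n) (seq y n)
        }
      ; *-cong = λ {x} {y} {u} {v} x≈y u≈v → null (Lim₁.vanishes-resp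
          (λ n → prod-diff (seq x n) (seq u n) (seq y n) (seq v n))
          (Lim₁.vanishes-+
            (Lim₁.vanishes-* (bounded x) (difference-null u≈v))
            (Lim₁.vanishes-* (bounded v) (difference-null x≈y))))
      ; *-assoc = λ x y z → pointwise λ n →
          ℚ.*-assoc (seq x n) (seq y n) (seq z n)
      ; *-identity = (λ x → pointwise λ n → ℚ.*-identityˡ (seq x n))
                   , (λ x → pointwise λ n → ℚ.*-identityʳ (seq x n))
      ; distrib = (λ x y z → pointwise λ n →
                     ℚ.*-distribˡ-+ (seq x n) (seq y n) (seq z n))
                , (λ x y z → pointwise λ n →
                     ℚ.*-distribʳ-+ (seq x n) (seq y n) (seq z n))
      }
    ; *-comm = λ x y → pointwise λ n → ℚ.*-comm (seq x n) (seq y n)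
    }
  }

------------------------------------------------------------------------
-- R[i] for a commutative ring R; (a , b) stands for a + b i.

module AdjoinI {c ℓ} (R : CommutativeRing c ℓ) where
  open CommutativeRing R
  open RingProperties ring
  open CommutativeSemigroupProperties +-commutativeSemigroup
    using (interchange)
  private module Diff = DifferenceIdentities R
  open SetoidReasoning setoid

  private
    Gaussian : Set c
    Gaussian = Carrier × Carrier

    infixl 7 _·_
    _·_ : Gaussian → Gaussian → Gaussian
    (a , b) · (c , d) = a * c - b * d , a * d + b * c

    x-0y : ∀ x y → x - 0# * y ≈ x
    x-0y x y = trans (+-congˡ (trans (-‿cong (zeroˡ y)) -0#≈0#)) (+-identityʳ x)

    ·-comm : ∀ x y → proj₁ (x · y) ≈ proj₁ (y · x)
                   × proj₂ (x · y) ≈ proj₂ (y · x)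
    ·-comm (a , b) (c , d)
      = +-cong (*-comm a c) (-‿cong (*-comm b d))
      , trans (+-comm (a * d) (b * c)) (+-cong (*-comm b c) (*-comm a d))

    ·-identityˡ : ∀ x → proj₁ ((1# , 0#) · x) ≈ proj₁ x
                      × proj₂ ((1# , 0#) · x) ≈ proj₂ x
    ·-identityˡ (a , b)
      = trans (x-0y (1# * a) b) (*-identityˡ a)
      , trans (+-cong (*-identityˡ b) (zeroˡ a)) (+-identityʳ b)

    ·-distribˡ : (x y z : Gaussian) →
      let (a , b) = x ; (c , d) = y ; (e , f) = z in
        a * (c + e) - b * (d + f) ≈ (a * c - b * d) + (a * e - b * f)
      × a * (d + f) + b * (c + e) ≈ (a * d + b * c) + (a * f + b * e)
    ·-distribˡ (a , b) (c , d) (e , f)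
      = trans (+-cong (distribˡ a c e) (-‿cong (distribˡ b d f)))
              (sym (Diff.sum-diff (a * c) (a * e) (b * d) (b * f)))
      , trans (+-cong (distribˡ a d f) (distribˡ b c e))
              (interchange (a * d) (a * f) (b * c) (b * e))

    subtract-twice : ∀ p q t → (p - q) - t ≈ p - (q + t)
    subtract-twice p q t =
      trans (+-assoc p (- q) (- t)) (+-congˡ (-‿+-comm q t))

    ·-assoc : ∀ x y z → proj₁ (x · y · z) ≈ proj₁ (x · (y · z))
                      × proj₂ (x · y · z) ≈ proj₂ (x · (y · z))
    ·-assoc (a , b) (c , d) (e , f) = re , im
      where
      re : (a * c - b * d) * e - (a * d + b * c) * f ≈
           a * (c * e - d * f) - b * (c * f + d * e)
      re = begin
        (a * c - b * d) * e - (a * d + b * c) * f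
          ≈⟨ +-cong ([y-z]x≈yx-zx e (a * c) (b * d))
                    (-‿cong (distribʳ f (a * d) (b * c))) ⟩
        (a * c * e - b * d * e) - (a * d * f + b * c * f)
          ≈⟨ +-cong (+-cong (*-assoc a c e) (-‿cong (*-assoc b d e)))
                    (-‿cong (+-cong (*-assoc a d f) (*-assoc b c f))) ⟩
        (a * (c * e) - b * (d * e)) - (a * (d * f) + b * (c * f))
          ≈⟨ subtract-twice _ _ _ ⟩
        a * (c * e) - (b * (d * e) + (a * (d * f) + b * (c * f)))
          ≈⟨ +-congˡ (-‿cong (trans (+-comm _ _) (+-assoc _ _ _))) ⟩
        a * (c * e) - (a * (d * f) + (b * (c * f) + b * (d * e)))
          ≈⟨ subtract-twice _ _ _ ⟨
        (a * (c * e) - a * (d * f)) - (b * (c * f) + b * (d * e))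
          ≈⟨ +-cong (x[y-z]≈xy-xz a (c * e) (d * f))
                    (-‿cong (distribˡ b (c * f) (d * e))) ⟨
        a * (c * e - d * f) - b * (c * f + d * e) ∎

      im : (a * c - b * d) * f + (a * d + b * c) * e ≈
           a * (c * f + d * e) + b * (c * e - d * f)
      im = begin
        (a * c - b * d) * f + (a * d + b * c) * e
          ≈⟨ +-cong ([y-z]x≈yx-zx f (a * c) (b * d))
                    (distribʳ e (a * d) (b * c)) ⟩
        (a * c * f - b * d * f) + (a * d * e + b * c * e)
          ≈⟨ +-cong (+-cong (*-assoc a c f) (-‿cong (*-assoc b d f)))
                    (+-cong (*-assoc a d e) (*-assoc b c e)) ⟩
        (a * (c * f) - b * (d * f)) + (a * (d * e) + b * (c * e))
          ≈⟨ interchange _ _ _ _ ⟩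
        (a * (c * f) + a * (d * e)) + (- (b * (d * f)) + b * (c * e))
          ≈⟨ +-congˡ (+-comm _ _) ⟩
        (a * (c * f) + a * (d * e)) + (b * (c * e) - b * (d * f))
          ≈⟨ +-cong (distribˡ a (c * f) (d * e))
                    (x[y-z]≈xy-xz b (c * e) (d * f)) ⟨
        a * (c * f + d * e) + b * (c * e - d * f) ∎

  commutativeRing : CommutativeRing c ℓ
  commutativeRing = record
    { Carrier = Gaussian
    ; _≈_ = λ { (a , b) (c , d) → a ≈ c × b ≈ d }
    ; _+_ = λ { (a , b) (c , d) → a + c , b + d }
    ; _*_ = _·_
    ; -_  = λ { (a , b) → - a , - b }
    ; 0#  = 0# , 0#
    ; 1#  = 1# , 0#
    ; isCommutativeRing = record
      { isRing = record
        { +-isAbelianGroup = record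
          { isGroup = record
            { isMonoid = record
              { isSemigroup = record
                { isMagma = record
                  { isEquivalence = record
                    { refl  = refl , refl
                    ; sym   = λ { (p , q) → sym p , sym q }
                    ; trans = λ { (p , q) (r , s) → trans p r , trans q s }
                    }
                  ; ∙-cong = λ { (p , q) (r , s) → +-cong p r , +-cong q s }
                  }
                ; assoc = λ { (a , b) (c , d) (e , f) →
                    +-assoc a c e , +-assoc b d f }
                }
              ; identity = (λ { (a , b) → +-identityˡ a , +-identityˡ b })
                         , (λ { (a , b) → +-identityʳ a , +-identityʳ b })
              }
            ; inverse = (λ { (a , b) → -‿inverseˡ a , -‿inverseˡ b })
                      , (λ { (a , b) → -‿inverseʳ a , -‿inverseʳ b })
            ; ⁻¹-cong = λ { (p , q) → -‿cong p , -‿cong q }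
            }
          ; comm = λ { (a , b) (c , d) → +-comm a c , +-comm b d }
          }
        ; *-cong = λ { (p , q) (r , s) →
              +-cong (*-cong p r) (-‿cong (*-cong q s))
            , +-cong (*-cong p s) (*-cong q r) }
        ; *-assoc = ·-assoc
        ; *-identity = ·-identityˡ , λ x →
            let (p , q) = ·-comm x (1# , 0#) ; (r , s) = ·-identityˡ x
            in trans p r , trans q s
        ; distrib = ·-distribˡ , λ x y z →
            let (p , q) = ·-comm ((proj₁ y + proj₁ z) , (proj₂ y + proj₂ z)) x
                (r , s) = ·-distribˡ x y z
                (t , u) = ·-comm x y
                (v , w) = ·-comm x z
            in trans p (trans r (+-cong t v)) , trans q (trans s (+-cong u w))
        }
      ; *-comm = ·-comm
      }
    }

ℂ : CommutativeRing 0ℓ 0ℓ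
ℂ = AdjoinI.commutativeRing ℝ-commutativeRing

------------------------------------------------------------------------

module Projective {r ℓr} (R : CommutativeRing r ℓr) where
  open CommutativeRing R renaming (Carrier to K)
  open RingProperties ring using (-‿+-comm; -0#≈0#)
  -- n ⋆ x is the n-fold sum x + ⋯ + x, and x ^ n the n-fold product.
  open RawSemiringDefs (Semiring.rawSemiring semiring) public
    using (_^_; sum)
    renaming (_×_ to _⋆_)

  private
    module Sum = SumProperties +-commutativeMonoid
    module SemiringSum = SemiringSumProperties semiring

  Unit : K → Set (r ⊔ ℓr)
  Unit = Invertible _≈_ 1# _*_

  coordinateSpace : ℕ → Module R r ℓr
  coordinateSpace n = record
    { Carrierᴹ = Vector K n
    ; _≈ᴹ_ = λ v w → ∀ i → v i ≈ w i
    ; _+ᴹ_ = λ v w i → v i + w i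
    ; _*ₗ_ = λ a v i → a * v i
    ; _*ᵣ_ = λ v a i → a * v i
    ; 0ᴹ   = λ _ → 0#
    ; -ᴹ_  = λ v i → - v i
    ; isModule = IsModuleFromLeft.isModule {commutativeRing = R} record
      { isLeftModule = record
        { isLeftSemimodule = record
          { +ᴹ-isCommutativeMonoid = record
            { isMonoid = record
              { isSemigroup = record
                { isMagma = record
                  { isEquivalence = record
                    { refl  = λ _ → refl
                    ; sym   = λ p i → sym (p i)
                    ; trans = λ p q i → trans (p i) (q i)
                    }
                  ; ∙-cong = λ p q i → +-cong (p i) (q i)
                  }
                ; assoc = λ u v w i → +-assoc (u i) (v i) (w i)
                }
              ; identity = (λ v i → +-identityˡ (v i))
                         , (λ v i → +-identityʳ (v i))
              }
            ; comm = λ v w i → +-comm (v i) (w i)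
            }
          ; isPreleftSemimodule = record
            { *ₗ-cong      = λ p q i → *-cong p (q i)
            ; *ₗ-zeroˡ     = λ v i → zeroˡ (v i)
            ; *ₗ-distribʳ  = λ v a b i → distribʳ (v i) a b
            ; *ₗ-identityˡ = λ v i → *-identityˡ (v i)
            ; *ₗ-assoc     = λ a b v i → *-assoc a b (v i)
            ; *ₗ-zeroʳ     = λ a i → zeroʳ a
            ; *ₗ-distribˡ  = λ a v w i → distribˡ a (v i) (w i)
            }
          }
        ; -ᴹ‿cong = λ p i → -‿cong (p i)
        ; -ᴹ‿inverse = (λ v i → -‿inverseˡ (v i)) , (λ v i → -‿inverseʳ (v i))
        }
      }
    }

  private
    sum-neg : ∀ {n} (v : Vector K n) → sum (λ i → - v i) ≈ - sum v
    sum-neg {zero}  v = sym -0#≈0#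
    sum-neg {suc n} v = trans (+-congˡ (sum-neg (λ i → v (Fin.suc i))))
                              (-‿+-comm _ _)

  -- The hyperplane y₁ + ⋯ + yₙ = 0.
  sumZero : ℕ → Module R (r ⊔ ℓr) ℓr
  sumZero n = record
    { Carrierᴹ = Σ[ v ∈ Vector K n ] sum v ≈ 0#
    ; _≈ᴹ_ = λ { (v , _) (w , _) → v ≈ᴹ w }
    ; _+ᴹ_ = λ { (v , p) (w , q) → v +ᴹ w ,
        trans (Sum.∑-distrib-+ v w) (trans (+-cong p q) (+-identityˡ 0#)) }
    ; _*ₗ_ = scale
    ; _*ᵣ_ = λ v a → scale a v
    ; 0ᴹ   = 0ᴹ , Sum.sum-replicate-zero n
    ; -ᴹ_  = λ { (v , p) → -ᴹ v ,
        trans (sum-neg v) (trans (-‿cong p) -0#≈0#) }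
    ; isModule = IsModuleFromLeft.isModule {commutativeRing = R} record
      { isLeftModule = record
        { isLeftSemimodule = record
          { +ᴹ-isCommutativeMonoid = record
            { isMonoid = record
              { isSemigroup = record
                { isMagma = record
                  { isEquivalence = record
                    { refl = ≈ᴹ-refl ; sym = ≈ᴹ-sym ; trans = ≈ᴹ-trans }
                  ; ∙-cong = +ᴹ-cong
                  }
                ; assoc = λ { (u , _) (v , _) (w , _) → +ᴹ-assoc u v w }
                }
              ; identity = (λ { (v , _) → +ᴹ-identityˡ v })
                         , (λ { (v , _) → +ᴹ-identityʳ v })
              }
            ; comm = λ { (v , _) (w , _) → +ᴹ-comm v w }
            }
          ; isPreleftSemimodule = record
            { *ₗ-cong      = *ₗ-cong
            ; *ₗ-zeroˡ     = λ { (v , _) → *ₗ-zeroˡ v }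
            ; *ₗ-distribʳ  = λ { (v , _) → *ₗ-distribʳ v }
            ; *ₗ-identityˡ = λ { (v , _) → *ₗ-identityˡ v }
            ; *ₗ-assoc     = λ { a b (v , _) → *ₗ-assoc a b v }
            ; *ₗ-zeroʳ     = *ₗ-zeroʳ
            ; *ₗ-distribˡ  = λ { a (v , _) (w , _) → *ₗ-distribˡ a v w }
            }
          }
        ; -ᴹ‿cong = -ᴹ‿cong
        ; -ᴹ‿inverse = (λ { (v , _) → -ᴹ‿inverseˡ v })
                     , (λ { (v , _) → -ᴹ‿inverseʳ v })
        }
      }
    }
    where
    open Module (coordinateSpace n)
    scale : K → Σ[ v ∈ Vector K n ] sum v ≈ 0# →
                Σ[ v ∈ Vector K n ] sum v ≈ 0#
    scale a (v , p) = a *ₗ v ,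
      trans (sym (SemiringSum.*-distribˡ-sum a v))
            (trans (*-congˡ p) (zeroʳ a))

  -- Points are represented by nonzero vectors and identified up to
  -- multiplication by a unit.
  ℙ : ∀ {m ℓm} → Module R m ℓm → Setoid (m ⊔ ℓm) (r ⊔ ℓr ⊔ ℓm)
  ℙ M = record
    { Carrier = Σ[ v ∈ Carrierᴹ ] ¬ (v ≈ᴹ 0ᴹ)
    ; _≈_ = λ { (v , _) (w , _) → Σ[ a ∈ K ] Unit a × v ≈ᴹ a *ₗ w }
    ; isEquivalence = record
      { refl  = 1# , (1# , *-identityˡ 1# , *-identityˡ 1#)
              , ≈ᴹ-sym (*ₗ-identityˡ _)
      ; sym   = λ { (a , (b , ba≈1 , ab≈1) , v≈aw) →
          b , (a , ab≈1 , ba≈1) ,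
          ≈ᴹ-sym (≈ᴹ-trans (*ₗ-congˡ v≈aw)
                 (≈ᴹ-trans (≈ᴹ-sym (*ₗ-assoc b a _))
                 (≈ᴹ-trans (*ₗ-congʳ ba≈1) (*ₗ-identityˡ _)))) }
      ; trans = λ { (a , (a′ , a′a≈1 , _) , u≈av)
                    (b , (b′ , b′b≈1 , _) , v≈bw) →
          let inv = begin
                b′ * a′ * (a * b)    ≈⟨ *-assoc b′ a′ (a * b) ⟩
                b′ * (a′ * (a * b))  ≈⟨ *-congˡ (*-assoc a′ a b) ⟨
                b′ * (a′ * a * b)    ≈⟨ *-congˡ (*-congʳ a′a≈1) ⟩
                b′ * (1# * b)        ≈⟨ *-congˡ (*-identityˡ b) ⟩
                b′ * b               ≈⟨ b′b≈1 ⟩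
                1#                   ∎
          in a * b , (b′ * a′ , inv , trans (*-comm _ _) inv) ,
             ≈ᴹ-trans u≈av (≈ᴹ-trans (*ₗ-congˡ v≈bw)
                                     (≈ᴹ-sym (*ₗ-assoc a b _))) }
      }
    }
    where
    open Module M
    open SetoidReasoning setoid

  -- The points of ℙ M at which F vanishes; F is meant to be homogeneous.
  zeroLocus : ∀ {m ℓm} (M : Module R m ℓm) → (Module.Carrierᴹ M → K) →
              Pred (Setoid.Carrier (ℙ M)) ℓr
  zeroLocus M F (v , _) = F v ≈ 0#

  module _ {m ℓm n ℓn} (M : Module R m ℓm) (N : Module R n ℓn) where
    private
      module M = Module M
      module N = Module N
    open ModuleMorphisms M.rawModule N.rawModule public
      using (IsModuleIsomorphism)

    ℙ-map : (φ : M.Carrierᴹ → N.Carrierᴹ) → IsModuleIsomorphism φ →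
            Setoid.Carrier (ℙ M) → Setoid.Carrier (ℙ N)
    ℙ-map φ iso (v , v≉0) = φ v , λ φv≈0 →
      v≉0 (injective (N.≈ᴹ-trans φv≈0 (N.≈ᴹ-sym 0ᴹ-homo)))
      where open IsModuleIsomorphism iso

    -- The hypersurfaces F = 0 in ℙ M and G = 0 in ℙ N correspond under a
    -- linear change of coordinates, both as sets of points and through
    -- their equations (which define a hypersurface up to a unit).
    SameUpToLinearChange : (M.Carrierᴹ → K) → (N.Carrierᴹ → K) →
                           Set (r ⊔ ℓr ⊔ m ⊔ ℓm ⊔ n ⊔ ℓn)
    SameUpToLinearChange F G =
      Σ[ φ ∈ (M.Carrierᴹ → N.Carrierᴹ) ]
      Σ[ iso ∈ IsModuleIsomorphism φ ]
        (∀ p → p ∈ zeroLocus M F ⇔ ℙ-map φ iso p ∈ zeroLocus N G)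
        × (Σ[ c ∈ K ] Unit c × (∀ v → F v ≈ c * G (φ v)))

  -- The k-element sublists of xs, one for each choice of k positions.
  sublists : ∀ {a} {A : Set a} → ℕ → List A → List (List A)
  sublists zero    _        = [] ∷ []
  sublists (suc k) []       = []
  sublists (suc k) (x ∷ xs) =
    List.map (x ∷_) (sublists k xs) ++ sublists (suc k) xs

  σ : ℕ → ∀ {n} → Vector K n → K
  σ k f = List.foldr _+_ 0#
    (List.map (List.foldr _*_ 1#) (sublists k (Vector.toList f)))

  quinaryCubic : Vector K 5 → K
  quinaryCubic f = 5 ⋆ σ 1 f ^ 3 - 18 ⋆ (σ 1 f * σ 2 f) + 27 ⋆ σ 3 f

  -- A form on the hyperplane, so that its zero locus lies in ℙ (sumZero 6).
  segreCubic : Module.Carrierᴹ (sumZero 6) → K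
  segreCubic (y , _) = sum (λ i → y i ^ 3)

{-# OPTIONS --safe #-}
-- When n + 1 is invertible, f ↦ (m , f₁ + m , … , fₙ + m), where
-- m = - (f₁ + ⋯ + fₙ) / (n + 1), identifies Kⁿ with the hyperplane
-- y₀ + ⋯ + yₙ = 0; the inverse is fᵢ = yᵢ - y₀.  On the hyperplane
-- - y₀ = y₁ + ⋯ + yₙ, so for n = 5 the substitution fᵢ = yᵢ + (y₁ + ⋯ + y₅)
-- turns the comparison of the two cubics into a polynomial identity in
-- y₁, …, y₅, namely that the quinary cubic is 9 (y₀³ + ⋯ + y₅³).
module Submission where

open import Algebra.Bundles using (CommutativeRing)
open import Algebra.Module.Bundles using (Module)
import Algebra.Properties.CommutativeMonoid.Sum as SumProperties
import Algebra.Properties.CommutativeSemigroup as CommutativeSemigroupProperties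
import Algebra.Properties.Ring as RingProperties
import Algebra.Properties.Semiring.Exp as ExpProperties
import Algebra.Properties.Semiring.Mult as MultProperties
import Algebra.Properties.Semiring.Sum as SemiringSumProperties
import Algebra.Solver.Ring.NaturalCoefficients.Default as NaturalCoefficients
open import Data.Fin.Base using (zero; suc)
open import Data.Integer.Base using (1ℤ)
open import Data.List.Base as List using ([]; _∷_)
open import Data.List.Relation.Binary.Pointwise as Pointwise
  using (Pointwise; []; _∷_)
open import Data.Nat.Base using (ℕ; zero; suc)
open import Data.Product.Base using (_,_)
open import Data.Rational.Base as ℚ using (0ℚ)
import Data.Vec.Base as Vec
open import Data.Vec.Functional as Vector using (Vector)
open import Function.Bundles using (mk⇔)
open import Relation.Binary.PropositionalEquality as ≡ using (_≡_)
import Relation.Binary.Reasoning.Setoid as SetoidReasoning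

open import Defs

module LinearChange {c ℓ} (R : CommutativeRing c ℓ) where
  open CommutativeRing R hiding (zero) renaming (Carrier to K)
  open Projective R
  open RingProperties ring
  open CommutativeSemigroupProperties +-commutativeSemigroup
    using (interchange)
  open SumProperties +-commutativeMonoid
    using (∑-distrib-+; sum-replicate; sum-cong-≋)
  open SemiringSumProperties semiring using (*-distribˡ-sum)
  open MultProperties semiring using (×-congʳ; ×-assoc-*; ×-comm-*)
  open ExpProperties semiring using (^-congˡ)
  open SetoidReasoning setoid

  -- Cancellation, translated sums and integer multiples in a commutative ring.

  a+b-b≈a : ∀ a b → (a + b) - b ≈ a
  a+b-b≈a a b = begin
    (a + b) - b  ≈⟨ +-assoc a b (- b) ⟩
    a + (b - b)  ≈⟨ +-congˡ (-‿inverseʳ b) ⟩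
    a + 0#       ≈⟨ +-identityʳ a ⟩
    a            ∎

  a-b+b≈a : ∀ a b → (a - b) + b ≈ a
  a-b+b≈a a b = begin
    (a - b) + b    ≈⟨ +-assoc a (- b) b ⟩
    a + (- b + b)  ≈⟨ +-congˡ (-‿inverseˡ b) ⟩
    a + 0#         ≈⟨ +-identityʳ a ⟩
    a              ∎

  sum-translate : ∀ {n} (f : Vector K n) m →
                  sum (λ i → f i + m) ≈ sum f + n ⋆ m
  sum-translate {n} f m =
    trans (∑-distrib-+ f (λ _ → m)) (+-congˡ (sum-replicate n))

  ⋆-neg : ∀ n x → n ⋆ (- x) ≈ - (n ⋆ x)
  ⋆-neg n x = begin
    n ⋆ (- x)          ≈⟨ ×-congʳ n (-1*x≈-x x) ⟨
    n ⋆ (- 1# * x)     ≈⟨ ×-comm-* n (- 1#) x ⟨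
    - 1# * (n ⋆ x)     ≈⟨ -1*x≈-x (n ⋆ x) ⟩
    - (n ⋆ x)          ∎

  -- The linear isomorphism from affine coordinates to the sum-zero hyperplane.

  module Hyperplane (n : ℕ) (k : K) (inverse : suc n ⋆ k ≈ 1#) where
    private
      Kⁿ H : Module R _ _
      Kⁿ = coordinateSpace n
      H  = sumZero (suc n)
      module Kⁿ = Module Kⁿ
      module H = Module H

    sucn⋆k*x : ∀ x → suc n ⋆ (k * x) ≈ x
    sucn⋆k*x x = begin
      suc n ⋆ (k * x)  ≈⟨ ×-assoc-* (suc n) k x ⟨
      (suc n ⋆ k) * x  ≈⟨ *-congʳ inverse ⟩
      1# * x           ≈⟨ *-identityˡ x ⟩
      x                ∎

    shift : Vector K n → K
    shift f = - (k * sum f)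

    shift-cong : ∀ {f g} → f Kⁿ.≈ᴹ g → shift f ≈ shift g
    shift-cong f≈g = -‿cong (*-congˡ (sum-cong-≋ f≈g))

    shift-+ : ∀ f g → shift (f Kⁿ.+ᴹ g) ≈ shift f + shift g
    shift-+ f g = begin
      - (k * sum (λ i → f i + g i))   ≈⟨ -‿cong (*-congˡ (∑-distrib-+ f g)) ⟩
      - (k * (sum f + sum g))         ≈⟨ -‿cong (distribˡ k _ _) ⟩
      - (k * sum f + k * sum g)       ≈⟨ -‿+-comm _ _ ⟨
      - (k * sum f) - (k * sum g)     ∎

    shift-* : ∀ a f → shift (a Kⁿ.*ₗ f) ≈ a * shift f
    shift-* a f = begin
      - (k * sum (λ i → a * f i))  ≈⟨ -‿cong (*-congˡ (*-distribˡ-sum a f)) ⟨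
      - (k * (a * sum f))          ≈⟨ -‿cong (x∙yz≈y∙xz k a (sum f)) ⟩
      - (a * (k * sum f))          ≈⟨ -‿distribʳ-* a _ ⟩
      a * - (k * sum f)            ∎
      where
      open CommutativeSemigroupProperties *-commutativeSemigroup
        using (x∙yz≈y∙xz)

    translates : Vector K n → Vector K (suc n)
    translates f zero    = shift f
    translates f (suc i) = f i + shift f

    sum-translates : ∀ f → sum (translates f) ≈ 0#
    sum-translates f = begin
      m + sum (λ i → f i + m)        ≈⟨ +-congˡ (sum-translate f m) ⟩
      -- Moved past `sum f`, the separate `m` joins the `n` copies; their sum is `suc n ⋆ m` by
      -- definition.
      m + (sum f + n ⋆ m)            ≈⟨ x∙yz≈y∙xz m (sum f) (n ⋆ m) ⟩
      sum f + suc n ⋆ m              ≈⟨ +-congˡ (⋆-neg (suc n) _) ⟩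
      sum f - suc n ⋆ (k * sum f)    ≈⟨ +-congˡ (-‿cong (sucn⋆k*x _)) ⟩
      sum f - sum f                  ≈⟨ -‿inverseʳ _ ⟩
      0#                             ∎
      where
      m = shift f
      open CommutativeSemigroupProperties +-commutativeSemigroup
        using (x∙yz≈y∙xz)

    φ : Kⁿ.Carrierᴹ → H.Carrierᴹ
    φ f = translates f , sum-translates f

    ψ : H.Carrierᴹ → Kⁿ.Carrierᴹ
    ψ (y , _) i = y (suc i) - y zero

    φ-cong : ∀ {f g} → f Kⁿ.≈ᴹ g → φ f H.≈ᴹ φ g
    φ-cong f≈g zero    = shift-cong f≈g
    φ-cong f≈g (suc i) = +-cong (f≈g i) (shift-cong f≈g)

    φ-+ : ∀ f g → φ (f Kⁿ.+ᴹ g) H.≈ᴹ φ f H.+ᴹ φ g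
    φ-+ f g zero    = shift-+ f g
    φ-+ f g (suc i) = trans (+-congˡ (shift-+ f g)) (interchange _ _ _ _)

    φ-* : ∀ a f → φ (a Kⁿ.*ₗ f) H.≈ᴹ a H.*ₗ φ f
    φ-* a f zero    = shift-* a f
    φ-* a f (suc i) = trans (+-congˡ (shift-* a f)) (sym (distribˡ a _ _))

    -- Follows from homogeneity `φ-*`, since the zero vector is `0#` times itself.
    φ-0 : φ Kⁿ.0ᴹ H.≈ᴹ H.0ᴹ
    φ-0 i = trans (φ-cong {0ᶠ} {0# Kⁿ.*ₗ 0ᶠ} (λ _ → sym (zeroˡ 0#)) i)
              (trans (φ-* 0# 0ᶠ i) (zeroˡ _))
      where
      0ᶠ : Vector K n
      0ᶠ = Kⁿ.0ᴹ

    φ-neg : ∀ f → φ (Kⁿ.-ᴹ f) H.≈ᴹ H.-ᴹ φ f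
    φ-neg f i =
      trans (φ-cong {Kⁿ.-ᴹ f} {(- 1#) Kⁿ.*ₗ f} (λ j → sym (-1*x≈-x (f j))) i)
            (trans (φ-* (- 1#) f i) (-1*x≈-x (translates f i)))

    ψ∘φ : ∀ f → ψ (φ f) Kⁿ.≈ᴹ f
    ψ∘φ f i = a+b-b≈a (f i) (shift f)

    sum-tail : ∀ ((y , _) : H.Carrierᴹ) → sum (λ i → y (suc i)) ≈ - y zero
    sum-tail (y , Σy≈0) = x+y≈0⇒y≈-x Σy≈0
      where
      x+y≈0⇒y≈-x : ∀ {a b} → a + b ≈ 0# → b ≈ - a
      x+y≈0⇒y≈-x {a} {b} p = begin
        b              ≈⟨ a+b-b≈a b a ⟨
        (b + a) - a    ≈⟨ +-congʳ (trans (+-comm b a) p) ⟩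
        0# - a         ≈⟨ +-identityˡ (- a) ⟩
        - a            ∎

    -- The tail of `y` contributes `- y zero` and the `n` subtractions contribute `n` more copies,
    -- so the entries of `ψ v` add up to `suc n ⋆ (- y zero)`; multiplying by `k` and negating
    -- leaves `y zero`.
    shift-ψ : (v@(y , _) : H.Carrierᴹ) → shift (ψ v) ≈ y zero
    shift-ψ v@(y , _) = begin
      - (k * sum (ψ v))
        ≈⟨ -‿cong (*-congˡ (sum-translate (λ i → y (suc i)) (- y zero))) ⟩
      - (k * (sum (λ i → y (suc i)) + n ⋆ (- y zero)))
        ≈⟨ -‿cong (*-congˡ (+-congʳ (sum-tail v))) ⟩
      - (k * (suc n ⋆ (- y zero)))
        ≈⟨ -‿cong (×-comm-* (suc n) k (- y zero)) ⟩
      - (suc n ⋆ (k * - y zero))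
        ≈⟨ -‿cong (sucn⋆k*x _) ⟩
      - (- y zero)
        ≈⟨ -‿involutive _ ⟩
      y zero ∎

    φ∘ψ : ∀ v → φ (ψ v) H.≈ᴹ v
    φ∘ψ v zero          = shift-ψ v
    φ∘ψ v@(y , _) (suc i) =
      trans (+-congˡ (shift-ψ v)) (a-b+b≈a (y (suc i)) (y zero))

    φ-isIsomorphism : IsModuleIsomorphism Kⁿ H φ
    φ-isIsomorphism = record
      { isModuleMonomorphism = record
        { isModuleHomomorphism = record
          { isBimoduleHomomorphism = record
            { +ᴹ-isGroupHomomorphism = record
              { isMonoidHomomorphism = record
                { isMagmaHomomorphism = record
                  { isRelHomomorphism = record { cong = φ-cong }
                  ; homo = φ-+
                  }
                ; ε-homo = φ-0
                }
              ; ⁻¹-homo = φ-neg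
              }
            ; *ₗ-homo = φ-*
            ; *ᵣ-homo = λ a f → φ-* a f
            }
          }
        ; injective = λ {f} {g} φf≈φg i → begin
            f i            ≈⟨ ψ∘φ f i ⟨
            ψ (φ f) i      ≈⟨ +-cong (φf≈φg (suc i)) (-‿cong (φf≈φg zero)) ⟩
            ψ (φ g) i      ≈⟨ ψ∘φ g i ⟩
            g i            ∎
        }
      ; surjective = λ v → ψ v , λ f≈ψv i →
          trans (φ-cong f≈ψv i) (φ∘ψ v i)
      }

  -- Congruence of the elementary symmetric polynomials and of the quinary cubic.

  -- Vectors are functions compared entry by entry, so congruence of `σ` has to be carried through
  -- each list operation in its definition, this one included.
  sublists⁺ : ∀ k {xs ys} → Pointwise _≈_ xs ys →
              Pointwise (Pointwise _≈_) (sublists k xs) (sublists k ys)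
  sublists⁺ zero    _            = [] ∷ []
  sublists⁺ (suc k) []           = []
  sublists⁺ (suc k) (x≈y ∷ rest) = Pointwise.++⁺
    (Pointwise.map⁺ _ _ (Pointwise.map (x≈y ∷_) (sublists⁺ k rest)))
    (sublists⁺ (suc k) rest)

  σ-cong : ∀ k {n} {f g : Vector K n} → (∀ i → f i ≈ g i) → σ k f ≈ σ k g
  σ-cong k f≈g = Pointwise.foldr⁺ {R = _≈_} +-cong refl
    (Pointwise.map⁺ _ _
      (Pointwise.map (Pointwise.foldr⁺ {R = _≈_} *-cong refl)
        (sublists⁺ k (Pointwise.tabulate⁺ f≈g))))

  quinaryCubic-cong : ∀ {f g : Vector K 5} → (∀ i → f i ≈ g i) →
                      quinaryCubic f ≈ quinaryCubic g
  quinaryCubic-cong f≈g = +-cong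
    (+-cong (×-congʳ 5 (^-congˡ 3 (σ-cong 1 f≈g)))
            (-‿cong (×-congʳ 18 (*-cong (σ-cong 1 f≈g) (σ-cong 2 f≈g)))))
    (×-congʳ 27 (σ-cong 3 f≈g))

  -- The polynomial identity in five variables.

  module _ (v : Vector K 5) where
    private
      s : K
      s = sum v

      f : Vector K 5
      f i = v i + s

    -- The equation below with both sides moved so that no subtraction
    -- occurs, which makes it an identity over any commutative semiring.
    translated-cubic-semiring :
      (5 ⋆ σ 1 f ^ 3 + 27 ⋆ σ 3 f) + 9 ⋆ s ^ 3 ≈
      9 ⋆ sum (λ i → v i ^ 3) + 18 ⋆ (σ 1 f * σ 2 f)
    translated-cubic-semiring = prove (Vec.tabulate v)
      ((5 :× (σᵖ 1 :³) :+ 27 :× σᵖ 3) :+ 9 :× (sᵖ :³))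
      (9 :× sumᵖ (λ i → var i :³) :+ 18 :× (σᵖ 1 :* σᵖ 2))
      refl
      where
      open NaturalCoefficients commutativeSemiring
      -- The polynomials repeat the folds of `sum`, `σ` and `_^_`, final units included, so that
      -- they evaluate to the two sides exactly as stated.
      sumᵖ : ∀ {n} → Vector (Polynomial 5) n → Polynomial 5
      sumᵖ = Vector.foldr _:+_ (con 0)
      sᵖ : Polynomial 5
      sᵖ = sumᵖ var
      σᵖ : ℕ → Polynomial 5
      σᵖ k = List.foldr _:+_ (con 0) (List.map (List.foldr _:*_ (con 1))
               (sublists k (Vector.toList (λ i → var i :+ sᵖ))))
      _:³ : Polynomial 5 → Polynomial 5
      p :³ = p :* (p :* (p :* con 1))

    -- On the hyperplane `s` is minus the remaining coordinate, so `- 9 ⋆ s ^ 3` will provide the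
    -- missing cube of the Segre form.
    translated-cubic :
      quinaryCubic f ≈ 9 ⋆ sum (λ i → v i ^ 3) - 9 ⋆ s ^ 3
    translated-cubic = begin
      (a - b) + d              ≈⟨ +-assoc a (- b) d ⟩
      a + (- b + d)            ≈⟨ +-congˡ (+-comm (- b) d) ⟩
      a + (d - b)              ≈⟨ +-assoc a d (- b) ⟨
      -- Adding and removing `t` exposes the left side of the semiring identity.
      (a + d) - b              ≈⟨ +-congʳ (a+b-b≈a (a + d) t) ⟨
      (((a + d) + t) - t) - b  ≈⟨ +-congʳ (+-congʳ translated-cubic-semiring) ⟩
      ((p + b) - t) - b        ≈⟨ +-assoc (p + b) (- t) (- b) ⟩
      (p + b) + (- t - b)      ≈⟨ +-congˡ (+-comm (- t) (- b)) ⟩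
      (p + b) + (- b - t)      ≈⟨ +-assoc (p + b) (- b) (- t) ⟨
      ((p + b) - b) - t        ≈⟨ +-congʳ (a+b-b≈a p b) ⟩
      p - t                    ∎
      where
      a b d t p : K
      a = 5 ⋆ σ 1 f ^ 3
      b = 18 ⋆ (σ 1 f * σ 2 f)
      d = 27 ⋆ σ 3 f
      t = 9 ⋆ s ^ 3
      p = 9 ⋆ sum (λ i → v i ^ 3)

  -- Comparison of the two cubics when 6 is invertible.

  module _ (sixth : K) (inverse : 6 ⋆ sixth ≈ 1#) where
    open Hyperplane 5 sixth inverse

    cubics-agree : ∀ f → quinaryCubic f ≈ (9 ⋆ 1#) * segreCubic (φ f)
    cubics-agree f = begin
      quinaryCubic f
        -- Here `f i` is `v i - shift f`, and `- shift f` is `sum v` because `φ f` lies on the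
        -- hyperplane.
        ≈⟨ quinaryCubic-cong (λ i → sym (trans (+-congˡ (sum-tail (φ f)))
                                              (ψ∘φ f i))) ⟩
      quinaryCubic (λ i → v i + sum v)
        ≈⟨ translated-cubic v ⟩
      9 ⋆ P - 9 ⋆ sum v ^ 3
        ≈⟨ +-congˡ (⋆-neg 9 (sum v ^ 3)) ⟨
      9 ⋆ P + 9 ⋆ (- sum v ^ 3)
        -- Cubing is odd, so the two signs cancel and leave the cube of the zeroth coordinate of
        -- `φ f`.
        ≈⟨ +-congˡ (×-congʳ 9 (trans (-‿cong (^-congˡ 3 (sum-tail (φ f))))
                                     (neg-cube (shift f)))) ⟩
      9 ⋆ P + 9 ⋆ (shift f ^ 3)
        ≈⟨ +-comm _ _ ⟩
      9 ⋆ (shift f ^ 3) + 9 ⋆ P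
        ≈⟨ +-cong (9⋆x≈9*x _) (9⋆x≈9*x _) ⟩
      (9 ⋆ 1#) * shift f ^ 3 + (9 ⋆ 1#) * P
        ≈⟨ distribˡ (9 ⋆ 1#) _ _ ⟨
      (9 ⋆ 1#) * segreCubic (φ f) ∎
      where
      v : Vector K 5
      v i = f i + shift f
      P : K
      P = sum (λ i → v i ^ 3)
      9⋆x≈9*x : ∀ x → 9 ⋆ x ≈ (9 ⋆ 1#) * x
      9⋆x≈9*x x = sym (trans (×-assoc-* 9 1# x) (×-congʳ 9 (*-identityˡ x)))
      neg-cube : ∀ x → - ((- x) ^ 3) ≈ x ^ 3
      neg-cube x = begin
        - ((- x) * ((- x) * ((- x) * 1#)))
          ≈⟨ -‿distribˡ-* _ _ ⟩
        - (- x) * ((- x) * ((- x) * 1#))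
          ≈⟨ *-cong (-‿involutive x) (*-congˡ (sym (-‿distribˡ-* x 1#))) ⟩
        x * ((- x) * - (x * 1#))
          ≈⟨ *-congˡ (trans (sym (-‿distribˡ-* _ _))
                (trans (-‿cong (sym (-‿distribʳ-* _ _))) (-‿involutive _))) ⟩
        x ^ 3 ∎

    unit-9 : Unit (9 ⋆ 1#)
    unit-9 = u , trans (*-comm u (9 ⋆ 1#)) 9u≈1 , 9u≈1
      where
      u : K
      -- Since 9 · 4 = 6 · 6, the inverse of 9 is four times the square of `sixth`.
      u = 4 ⋆ (sixth * sixth)
      open NaturalCoefficients commutativeSemiring
      9u≈1 : (9 ⋆ 1#) * u ≈ 1#
      9u≈1 = begin
        (9 ⋆ 1#) * u
          ≈⟨ solve 1 (λ x → (9 :× con 1) :* (4 :× (x :* x)) :=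
                            (6 :× x) :* (6 :× x)) refl sixth ⟩
        (6 ⋆ sixth) * (6 ⋆ sixth)  ≈⟨ *-cong inverse inverse ⟩
        1# * 1#                    ≈⟨ *-identityˡ 1# ⟩
        1#                         ∎

    -- The forms differ by the unit 9 along `φ`, so a zero of one is a zero of the other: multiply
    -- by 9 in one direction and by its inverse in the other.
    quinary-same-as-segre : ∀ {F G} → F ≡ quinaryCubic → G ≡ segreCubic →
      SameUpToLinearChange (coordinateSpace 5) (sumZero 6) F G
    quinary-same-as-segre ≡.refl ≡.refl =
      φ , φ-isIsomorphism ,
      (λ { (f , _) → mk⇔
        (λ Ff≈0 → let (u , u*9≈1 , _) = unit-9 in begin
           segreCubic (φ f)                       ≈⟨ *-identityˡ _ ⟨
           1# * segreCubic (φ f)                  ≈⟨ *-congʳ u*9≈1 ⟨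
           (u * (9 ⋆ 1#)) * segreCubic (φ f)      ≈⟨ *-assoc _ _ _ ⟩
           u * ((9 ⋆ 1#) * segreCubic (φ f))      ≈⟨ *-congˡ (cubics-agree f) ⟨
           u * quinaryCubic f                     ≈⟨ *-congˡ Ff≈0 ⟩
           u * 0#                                 ≈⟨ zeroʳ u ⟩
           0#                                     ∎)
        (λ Gφf≈0 → trans (cubics-agree f) (trans (*-congˡ Gφf≈0) (zeroʳ _))) }) ,
      (9 ⋆ 1# , unit-9 , cubics-agree)

-- Specialisation to the complex numbers.

open Projective ℂ

sixth : CommutativeRing.Carrier ℂ
sixth = fromℚ (1ℤ ℚ./ 6) , fromℚ 0ℚ

-- Real and imaginary parts are constant sequences, so each difference is a closed rational that
-- computes to 0.
6⋆sixth≈1 : CommutativeRing._≈_ ℂ (6 ⋆ sixth) (CommutativeRing.1# ℂ)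
6⋆sixth≈1 = constant (λ _ → ≡.refl) , constant (λ _ → ≡.refl)
  where
  constant : ∀ {x y} → (∀ n → 0ℚ ≡ seq x n ℚ.- seq y n) → x ≈ᴿ y
  constant e = null (Lim₁.vanishes-resp e Lim₁.vanishes-0)

-- The forms stay variables while the types are instantiated at R = ℂ:
-- compared at concrete forms, the types would be unfolded into statements
-- about rational sequences.
same-over-ℂ : ∀ {F G} → F ≡ quinaryCubic → G ≡ segreCubic →
              SameUpToLinearChange (coordinateSpace 5) (sumZero 6) F G
same-over-ℂ = LinearChange.quinary-same-as-segre ℂ sixth 6⋆sixth≈1

corollary11 : SameUpToLinearChange (coordinateSpace 5) (sumZero 6) quinaryCubic segreCubic
corollary11 = same-over-ℂ ≡.refl ≡.refl
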